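{- If the permutation class $\mathcal{C}$ is labelled well-quasi-ordered (lwqo), then its substitution closure $\langle\mathcal{C}\rangle$ is also lwqo.
   Context: A permutation of length $n$ is an arrangement $\pi=\pi(1)\cdots\pi(n)$ of $1,\dots,n$ (the empty permutation is allowed). The permutation $\sigma$ of length $k$ is contained in $\pi$ of length $n$, written $\sigma\le\pi$, if there are indices $1\le i_1<\cdots<i_k\le n$ such that $\pi(i_1)\cdots\pi(i_k)$ is order isomorphic to $\sigma$. A permutation class is a set of permutations closed downward under containment. Given a permutation $\sigma$ of length $m$ and nonempty permutations $\alpha_1,\dots,\alpha_m$, the inflation $\sigma[\alpha_1,\dots,\alpha_m]$ is the permutation of length $|\alpha_1|+\cdots+|\alpha_m|$ obtained by replacing each entry $\sigma(i)$ by an interval (a set of entries with contiguous positions and contiguous values) order isomorphic to $\alpha_i$, so that the intervals are themselves order isomorphic to $\sigma$. For classes $\mathcal{C},\mathcal{U}$, $\mathcal{C}[\mathcal{U}]$ is the set of all $\sigma[\alpha_1,\dots,\alpha_m]$ with $\sigma\in\mathcal{C}$ of length $m$ and $\alpha_1,\dots,\alpha_m\in\mathcal{U}$ nonempty. A class $\mathcal{D}$ is substitution closed if $\mathcal{D}[\mathcal{D}]\subseteq\mathcal{D}$, and $\langle\mathcal{C}\rangle$ is the smallest substitution closed class containing $\mathcal{C}$. A quasi-order $(Y,\le)$ is well-quasi-ordered (wqo) if every infinite sequence $y_1,y_2,\dots$ in $Y$ has indices $i<j$ with $y_i\le y_j$. Given a quasi-order $(L,\le_L)$, an $L$-labelled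 permutation is a pair $(\pi,\ell_\pi)$ with $\pi$ a permutation of length $n$ and $\ell_\pi:\{1,\dots,n\}\to L$. We say $(\sigma,\ell_\sigma)\le(\pi,\ell_\pi)$, where $\sigma$ and $\pi$ have lengths $k$ and $n$, if there are indices $1\le i_1<\cdots<i_k\le n$ such that $\pi(i_1)\cdots\pi(i_k)$ is order isomorphic to $\sigma$ and $\ell_\sigma(j)\le_L\ell_\pi(i_j)$ for all $1\le j\le k$. For a set $X$ of permutations, $X\wr L$ is the set of all $L$-labelled members of $X$ under this order. The set $X$ is lwqo if $X\wr L$ is wqo for every wqo $(L,\le_L)$. -}

module Defs where

open import Level using (Level; 0ℓ; _⊔_) renaming (suc to lsuc)
open import Data.Nat as ℕ using (ℕ)
open import Data.Fin using (Fin; _<_)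
open import Data.Fin.Permutation using (Permutation′; _⟨$⟩ʳ_)
open import Data.Product using (Σ; ∃; ∃₂; _×_; _,_; proj₁; proj₂)
open import Function using (_∘_; id)
open import Function.Bundles using (_⇔_; mk⇔; Equivalence)
open import Function.Properties.Equivalence using (⇔-isEquivalence)
open import Relation.Binary.Bundles using (Preorder)
open import Relation.Binary.Structures using (IsEquivalence)
open import Relation.Binary.PropositionalEquality
  using (_≡_; _≢_; refl; isEquivalence)
open import Relation.Unary using (Pred; _⊆_)

private
  variable
    a b d ℓ ℓ₁ ℓ₂ : Level

------------------------------------------------------------------------
-- Permutations and containment

-- Positions and values are numbered from 0.
record Perm : Set where
  constructor mkPerm
  field
    ∣_∣  : ℕ
    perm : Permutation′ ∣_∣

  infix 8 _at_
  _at_ : Fin ∣_∣ → Fin ∣_∣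
  _at_ i = perm ⟨$⟩ʳ i

open Perm public

infix 4 _≼_

record _≼_ (σ π : Perm) : Set where
  field
    index      : Fin ∣ σ ∣ → Fin ∣ π ∣
    increasing : ∀ {i j} → i < j → index i < index j
    orderIso   : ∀ {i j} → (σ at i < σ at j) ⇔ (π at index i < π at index j)

open _≼_ public

≼-refl : ∀ {π} → π ≼ π
≼-refl = record
  { index      = id
  ; increasing = id
  ; orderIso   = IsEquivalence.refl ⇔-isEquivalence
  }

≼-trans : ∀ {ρ σ π} → ρ ≼ σ → σ ≼ π → ρ ≼ π
≼-trans f g = record
  { index      = index g ∘ index f
  ; increasing = increasing g ∘ increasing f
  ; orderIso   = IsEquivalence.trans ⇔-isEquivalence (orderIso f) (orderIso g)
  }

-- A downward closed set automatically respects pointwise equality of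
-- permutations, since pointwise equal permutations contain each other.
IsClass : Pred Perm ℓ → Set ℓ
IsClass C = ∀ {σ π} → σ ≼ π → C π → C σ

------------------------------------------------------------------------
-- Inflations

record IsInterval (π : Perm) (B : Pred (Fin ∣ π ∣) 0ℓ) : Set where
  field
    contiguousPositions :
      ∀ {p q r} → p < q → q < r → B p → B r → B q
    contiguousValues :
      ∀ {p q r} → π at p < π at q → π at q < π at r → B p → B r → B q

-- "π is the inflation σ[α₁,…,αₘ]", with `block p` the entry of σ whose
-- interval contains the entry of π at position p.  The intervals thus
-- partition π, which forces ∣ π ∣ to be the sum of the lengths of the αᵢ.
record IsInflation (σ : Perm) (α : Fin ∣ σ ∣ → Perm) (π : Perm) : Set where
  field
    block    : Fin ∣ π ∣ → Fin ∣ σ ∣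
    interval : ∀ i → IsInterval π (λ p → block p ≡ i)

    -- The i-th interval is order isomorphic to α i: it is exactly the
    -- set of entries of some copy of α i in π.
    copy       : ∀ i → α i ≼ π
    copy-block : ∀ i p → (block p ≡ i) ⇔ (∃ λ k → index (copy i) k ≡ p)

    -- The intervals are themselves order isomorphic to σ.
    blockPositions : ∀ {p q} → block p ≢ block q →
                     (p < q) ⇔ (block p < block q)
    blockValues    : ∀ {p q} → block p ≢ block q →
                     (π at p < π at q) ⇔ (σ at block p < σ at block q)

infix 9 _[_]

_[_] : Pred Perm a → Pred Perm b → Pred Perm (a ⊔ b)
(C [ U ]) π =
  ∃ λ σ → C σ ×
  Σ (Fin ∣ σ ∣ → Perm) λ α →
    (∀ i → 0 ℕ.< ∣ α i ∣ × U (α i)) × IsInflation σ α π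

SubstitutionClosed : Pred Perm ℓ → Set ℓ
SubstitutionClosed D = D [ D ] ⊆ D

data ⟨_⟩ {ℓ} (C : Pred Perm ℓ) : Pred Perm ℓ where
  include : C ⊆ ⟨ C ⟩
  down    : ∀ {σ π} → σ ≼ π → ⟨ C ⟩ π → ⟨ C ⟩ σ
  inflate : ⟨ C ⟩ [ ⟨ C ⟩ ] ⊆ ⟨ C ⟩

-- ⟨ C ⟩ is the smallest substitution closed class containing C.

⟨⟩-isClass : {C : Pred Perm ℓ} → IsClass ⟨ C ⟩
⟨⟩-isClass = down

⟨⟩-substitutionClosed : {C : Pred Perm ℓ} → SubstitutionClosed ⟨ C ⟩
⟨⟩-substitutionClosed = inflate

⟨⟩-smallest : {C : Pred Perm ℓ} {D : Pred Perm d} →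
              IsClass D → SubstitutionClosed D → C ⊆ D → ⟨ C ⟩ ⊆ D
⟨⟩-smallest cl sc C⊆D (include c)  = C⊆D c
⟨⟩-smallest cl sc C⊆D (down σ≼π x) = cl σ≼π (⟨⟩-smallest cl sc C⊆D x)
⟨⟩-smallest cl sc C⊆D (inflate (σ , x , α , y , inf)) =
  sc ( σ , ⟨⟩-smallest cl sc C⊆D x
     , α , (λ i → proj₁ (y i) , ⟨⟩-smallest cl sc C⊆D (proj₂ (y i)))
     , inf )

------------------------------------------------------------------------
-- Well-quasi-order and labelled permutations

-- The quasi-order is _≲_; the equality _≈_ carried by a Preorder plays
-- no role.
WQO : Preorder a ℓ₁ ℓ₂ → Set (a ⊔ ℓ₂)
WQO Y = ∀ (y : ℕ → Carrier) → ∃₂ λ i j → i ℕ.< j × y i ≲ y j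
  where open Preorder Y

module _ (X : Pred Perm ℓ) (L : Preorder a ℓ₁ ℓ₂) where

  private module L = Preorder L

  infix 5 _≀_

  record Labelled : Set (ℓ ⊔ a) where
    field
      shape  : Perm
      member : X shape
      label  : Fin ∣ shape ∣ → L.Carrier

  open Labelled

  _≼ₗ_ : Labelled → Labelled → Set ℓ₂
  s ≼ₗ t = Σ (shape s ≼ shape t) λ f →
           ∀ j → label s j L.≲ label t (index f j)

  _≀_ : Preorder (ℓ ⊔ a) (ℓ ⊔ a) ℓ₂
  _≀_ = record
    { Carrier    = Labelled
    ; _≈_        = _≡_
    ; _≲_        = _≼ₗ_
    ; isPreorder = record
      { isEquivalence = isEquivalence
      ; reflexive     = λ { refl → ≼-refl , λ _ → L.refl }
      ; trans         = λ { (f , f≲) (g , g≲) →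
                            ≼-trans f g ,
                            λ j → L.trans (f≲ j) (g≲ (index f j)) }
      }
    }

-- Labels range over all quasi-orders in the universe of X.
LWQO : Pred Perm ℓ → Set (lsuc ℓ)
LWQO {ℓ} X = ∀ (L : Preorder ℓ ℓ ℓ) → WQO L → WQO (X ≀ L)

{-# OPTIONS --safe #-}

-- An element of ⟨ C ⟩ embeds in the leaves of a finite tree whose inner nodes
-- carry members of C, read as an iterated inflation: such permutations are
-- closed downward because leaves may go unused, and closed under inflation by
-- grafting trees at leaves.  It therefore suffices that trees with leaves
-- labelled from a wqo are wqo under embeddings of their leaves.  In a minimal
-- bad sequence of trees the immediate subtrees form a wqo; each tree is either
-- a single labelled leaf or a member of C labelled by these subtrees, and both
-- kinds are wqo.
module Submission where

open import Defs
open import Axiom.ExcludedMiddle using (ExcludedMiddle)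
open import Relation.Unary using (Pred)

open import Data.Empty using (⊥-elim)
open import Data.Fin as Fin using (Fin)
import Data.Fin.Properties as Fin
open import Data.Fin.Permutation using (inverseˡ; _⟨$⟩ˡ_)
open import Data.Nat as ℕ using (ℕ; zero; suc; _+_; _∸_; _≤_; _<_; s≤s; z≤n)
open import Data.Nat.Induction using (<-wellFounded)
import Data.Nat.Properties as ℕ
open import Data.Product using (Σ; ∃; ∃₂; _×_; _,_; proj₁; proj₂)
open import Data.Sum using (_⊎_; inj₁; inj₂)
open import Data.Sum.Relation.Binary.Pointwise using (inj₁; inj₂; ⊎-preorder)
open import Data.Unit.Polymorphic using (⊤; tt)
open import Function using (_∘_; id)
open import Function.Bundles using (Equivalence; mk⇔)
open import Induction.WellFounded using (WellFounded; Acc; acc)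
open import Level using (Level; _⊔_)
open import Relation.Binary.Bundles using (Preorder)
import Relation.Binary.Construct.On as On
open import Relation.Binary.Core using (Rel)
open import Relation.Binary.Definitions using (tri<; tri≈; tri>)
open import Relation.Binary.PropositionalEquality
  using (_≡_; refl; sym; trans; cong; subst; subst₂; preorder; isEquivalence)
open import Relation.Nullary using (¬_; yes; no)

private
  variable
    a ℓ : Level
    A : Set a

-- Sequences and well-quasi-orders

Bad : Rel A ℓ → (ℕ → A) → Set ℓ
Bad _≲_ y = ∀ {i j} → i < j → ¬ (y i ≲ y j)

Good : Rel A ℓ → (ℕ → A) → Set ℓ
Good _≲_ y = ∃₂ λ i j → i < j × y i ≲ y j

stepwise⇒increasing : {h : ℕ → ℕ} → (∀ k → h k < h (suc k)) →
                      ∀ {i j} → i < j → h i < h j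
stepwise⇒increasing {h} step {i} {suc j} (s≤s i≤j) with ℕ.m≤n⇒m<n∨m≡n i≤j
... | inj₁ i<j  = ℕ.<-trans (stepwise⇒increasing {h} step i<j) (step j)
... | inj₂ refl = step i

splice : ℕ → (ℕ → A) → (ℕ → A) → ℕ → A
splice zero    f g i       = g i
splice (suc n) f g zero    = f zero
splice (suc n) f g (suc i) = splice n (f ∘ suc) g i

splice-< : ∀ {n i} (f g : ℕ → A) → i < n → splice n f g i ≡ f i
splice-< {n = suc n} {zero}  f g _         = refl
splice-< {n = suc n} {suc i} f g (s≤s i<n) = splice-< (f ∘ suc) g i<n

splice-≥ : ∀ {n i} (f g : ℕ → A) → n ≤ i → splice n f g i ≡ g (i ∸ n)
splice-≥ {n = zero}          f g _         = refl
splice-≥ {n = suc n} {suc i} f g (s≤s n≤i) = splice-≥ (f ∘ suc) g n≤i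

minimalElement : ∀ {a r p} {A : Set a} {_≺_ : Rel A r} →
  ExcludedMiddle (a ⊔ r ⊔ p) → (P : Pred A p) →
  ∀ {x} → Acc _≺_ x → P x → ∃ λ x → P x × (∀ {y} → y ≺ x → ¬ P y)
minimalElement {_≺_ = _≺_} em P {x} (acc rec) px
  with em {∃ λ y → y ≺ x × P y}
... | yes (y , y≺x , py) = minimalElement em P (rec y≺x) py
... | no ¬smaller        = x , px , λ y≺x py → ¬smaller (_ , y≺x , py)

module _ (em : ExcludedMiddle ℓ) where

  ¬Bad⇒Good : (_≲_ : Rel A ℓ) (y : ℕ → A) → ¬ Bad _≲_ y → Good _≲_ y
  ¬Bad⇒Good _≲_ y ¬bad with em {Good _≲_ y}
  ... | yes good = good
  ... | no ¬good = ⊥-elim (¬bad λ i<j le → ¬good (_ , _ , i<j , le))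


  -- Either some tail of `z` lies wholly on the left, where `wqoX` applies, or right-hand terms
  -- occur beyond every index and form an infinite subsequence for `wqoY`.
  WQO-⊎ : (X Y : Preorder ℓ ℓ ℓ) → WQO X → WQO Y → WQO (⊎-preorder X Y)
  WQO-⊎ X Y wqoX wqoY z
    with em {∃ λ n → ∀ k → ∃ λ x → z (n + k) ≡ inj₁ x}
  ... | yes (n , left) =
    let i , j , i<j , le = wqoX (proj₁ ∘ left)
    in  n + i , n + j , ℕ.+-monoʳ-< n i<j ,
        subst₂ (Preorder._≲_ (⊎-preorder X Y))
          (sym (proj₂ (left i))) (sym (proj₂ (left j))) (inj₁ le)
  ... | no ¬left =
    let i , j , i<j , le = wqoY (λ k → proj₁ (right k))
    in  h i , h j , stepwise⇒increasing {h} h-step i<j ,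
        subst₂ (Preorder._≲_ (⊎-preorder X Y))
          (sym (proj₂ (right i))) (sym (proj₂ (right j))) (inj₂ le)
    where
    next : ∀ n → ∃₂ λ k y → z (n + k) ≡ inj₂ y
    next n with em {∃₂ λ k y → z (n + k) ≡ inj₂ y}
    ... | yes found = found
    ... | no ¬found = ⊥-elim (¬left (n , λ k → onLeft k (z (n + k)) refl))
      where
      onLeft : ∀ k w → z (n + k) ≡ w → ∃ λ x → z (n + k) ≡ inj₁ x
      onLeft k (inj₁ x) eq = x , eq
      onLeft k (inj₂ y) eq = ⊥-elim (¬found (k , y , eq))

    -- The search for each right-hand term begins one past the previous hit, which makes `h`
    -- strictly increasing.
    start h : ℕ → ℕ
    start zero    = zero
    start (suc k) = suc (h k)
    h k = start k + proj₁ (next (start k))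

    h-step : ∀ k → h k < h (suc k)
    h-step k = ℕ.m≤m+n (suc (h k)) _

    right : ∀ k → ∃ λ y → z (h k) ≡ inj₂ y
    right k = proj₂ (next (start k))

  -- No separate choice principle is needed: excluded middle decides types and
  -- so returns witnesses.
  module MinimalBadSequence
    {A : Set ℓ} {_≲_ _◁_ : Rel A ℓ} (wf : WellFounded _◁_) where

    BadFrom : (ℕ → A) → ℕ → Pred A ℓ
    BadFrom f n x = ∃ λ g → Bad _≲_ g × (∀ {i} → i < n → g i ≡ f i) × g n ≡ x

    minimiseAt : ∀ f → Bad _≲_ f → ∀ n →
      ∃ λ x → BadFrom f n x × (∀ {y} → y ◁ x → ¬ BadFrom f n y)
    minimiseAt f bad n =
      minimalElement em (BadFrom f n) (wf (f n)) (f , bad , (λ _ → refl) , refl)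

    module _ (f : ℕ → A) (bad : Bad _≲_ f) where

      -- The first `n` terms of `stage n` are final; the next stage keeps them, makes term `n`
      -- minimal and may change everything later.
      stage : ℕ → ∃ (Bad _≲_)
      stage zero    = f , bad
      stage (suc n) =
        let g , bad-g , _ = proj₁ (proj₂ (minimiseAt _ (proj₂ (stage n)) n))
        in  g , bad-g

      stage-agree : ∀ {i} k {n} → i < n →
                    proj₁ (stage (k + n)) i ≡ proj₁ (stage n) i
      stage-agree zero    i<n = refl
      stage-agree (suc k) {n} i<n = trans
        (proj₁ (proj₂ (proj₂ (proj₁ (proj₂
          (minimiseAt _ (proj₂ (stage (k + n))) (k + n))))))
          (ℕ.<-≤-trans i<n (ℕ.m≤n+m n k)))
        (stage-agree k i<n)

      minimal : ℕ → A
      minimal n = proj₁ (stage (suc n)) n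

      stage≡minimal : ∀ {i n} → i < n → proj₁ (stage n) i ≡ minimal i
      stage≡minimal {i} {n} i<n =
        subst (λ m → proj₁ (stage m) i ≡ minimal i) (ℕ.m∸n+n≡m i<n)
          (stage-agree (n ∸ suc i) ℕ.≤-refl)

      -- Terms `i` and `j` already occur together in the single bad sequence `stage (suc j)`.
      minimal-bad : Bad _≲_ minimal
      minimal-bad {i} {j} i<j le = proj₂ (stage (suc j)) i<j
        (subst (_≲ minimal j) (sym (stage≡minimal (ℕ.m<n⇒m<1+n i<j))) le)

      minimal-minimal : ∀ n {x} → x ◁ minimal n → ¬ BadFrom minimal n x
      minimal-minimal n {x} x◁ (g , bad-g , agree , gn≡x) =
        proj₂ (proj₂ step)
          (subst (x ◁_) (proj₂ (proj₂ (proj₂ (proj₁ (proj₂ step))))) x◁)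
          (g , bad-g
             , (λ i<n → trans (agree i<n) (sym (stage≡minimal i<n))) , gn≡x)
        where step = minimiseAt _ (proj₂ (stage n)) n

  module _ (Y : Preorder ℓ ℓ ℓ) where
    open Preorder Y using (Carrier; _≲_) renaming (trans to ≲-trans)

    module _ (_◁_ : Rel Carrier ℓ) where

      Part : (ℕ → Carrier) → Set ℓ
      Part y = ∃₂ λ n s → s ◁ y n

      part : {y : ℕ → Carrier} → Part y → Carrier
      part (_ , s , _) = s

      parts : (ℕ → Carrier) → Preorder ℓ ℓ ℓ
      parts y = On.preorder Y (part {y})

      -- Nash-Williams' minimal bad sequence argument.
      WQO-fromParts : WellFounded _◁_ → (∀ {s t} → s ◁ t → s ≲ t) →
        (∀ y → WQO (parts y) → Good _≲_ y) → WQO Y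
      WQO-fromParts wf ◁⇒≲ good-if f = ¬Bad⇒Good _≲_ f λ bad →
        let i , j , i<j , le = good-if (minimal f bad) (wqo-parts f bad)
        in  minimal-bad f bad i<j le
        where
        open MinimalBadSequence {_≲_ = _≲_} wf

        -- Given a bad sequence `p` of parts, let `p k` have the least owner `n`. Following the
        -- first `n` terms of `m` by `p k`, `p (k + 1)`, and so on gives a bad sequence whose term
        -- `n` is a part of `m n`, against minimality.
        wqo-parts : ∀ f (bad : Bad _≲_ f) → WQO (parts (minimal f bad))
        wqo-parts f bad p = ¬Bad⇒Good (Preorder._≲_ (parts m)) p contra
          where
          m : ℕ → Carrier
          m = minimal f bad

          Owner : Pred ℕ ℓ
          Owner n = ∃₂ λ k x → p k ≡ (n , x)

          contra : ¬ Bad (Preorder._≲_ (parts m)) p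
          contra bad-p
            with minimalElement em Owner (<-wellFounded _) (0 , _ , refl)
          ... | n , (k , (s , s◁) , eq) , least =
            minimal-minimal f bad n s◁
              (h , h-bad , splice-< m q
                 , trans (h-≥ ℕ.≤-refl)
                     (trans (cong (λ d → part {m} (p (k + d))) (ℕ.n∸n≡0 n))
                       (trans (cong (part {m} ∘ p) (ℕ.+-identityʳ k))
                              (cong part eq))))
            where
            q h : ℕ → Carrier
            q i = part {m} (p (k + i))
            h = splice n m q

            h-≥ : ∀ {i} → n ≤ i → h i ≡ q (i ∸ n)
            h-≥ = splice-≥ m q

            owner-≥ : ∀ i → n ≤ proj₁ (p i)
            owner-≥ i = ℕ.≮⇒≥ λ lt → least lt (i , _ , refl)

            h-bad : Bad _≲_ h
            h-bad {i} {j} i<j le with i ℕ.<? n | j ℕ.<? n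
            ... | yes i<n | yes j<n = minimal-bad f bad i<j
                  (subst₂ _≲_ (splice-< m q i<n) (splice-< m q j<n) le)
            -- The part lies below its owner, whose index is at least `n` and so exceeds `i`;
            -- transitivity then contradicts the badness of `m`.
            ... | yes i<n | no j≮n =
                  minimal-bad f bad (ℕ.<-≤-trans i<n (owner-≥ _))
                    (≲-trans
                      (subst₂ _≲_ (splice-< m q i<n) (h-≥ (ℕ.≮⇒≥ j≮n)) le)
                      (◁⇒≲ (proj₂ (proj₂ (p (k + (j ∸ n)))))))
            ... | no i≮n | yes j<n = i≮n (ℕ.<-trans i<j j<n)
            ... | no i≮n | no j≮n =
                  bad-p (ℕ.+-monoʳ-< k (ℕ.∸-monoˡ-< i<j (ℕ.≮⇒≥ i≮n)))
                    (subst₂ _≲_ (h-≥ (ℕ.≮⇒≥ i≮n)) (h-≥ (ℕ.≮⇒≥ j≮n)) le)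

-- Trees of inflations

-- Keys let the orders by position and by value be treated uniformly.
data Key : Set where
  position value : Key

key : Key → (π : Perm) → Fin ∣ π ∣ → Fin ∣ π ∣
key position π = id
key value    π = π at_

key-injective : ∀ o π {p q} → key o π p ≡ key o π q → p ≡ q
key-injective position π eq = eq
key-injective value    π eq =
  trans (sym (inverseˡ (perm π)))
    (trans (cong (perm π ⟨$⟩ˡ_) eq) (inverseˡ (perm π)))

≼-mono : ∀ {σ π} (σ≼π : σ ≼ π) o {i j} →
  key o σ i Fin.< key o σ j →
  key o π (index σ≼π i) Fin.< key o π (index σ≼π j)
≼-mono σ≼π position = increasing σ≼π
≼-mono σ≼π value    = Equivalence.to (orderIso σ≼π)

-- Keys are injective into a linear order: if `p` does not precede `q`, they coincide or are
-- reversed, and asymmetry of `_≺_` excludes both.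
mono⇒reflects : ∀ {r} {A : Set a} (_≺_ : Rel A r) →
  (∀ {x y} → x ≺ y → ¬ y ≺ x) → ∀ o π (f : Fin ∣ π ∣ → A) →
  (∀ {p q} → key o π p Fin.< key o π q → f p ≺ f q) →
  ∀ {p q} → f p ≺ f q → key o π p Fin.< key o π q
mono⇒reflects _≺_ asym o π f mono {p} {q} fp≺fq
  with Fin.<-cmp (key o π p) (key o π q)
... | tri< p<q _ _ = p<q
... | tri≈ _ p≡q _ with refl ← key-injective o π p≡q =
  ⊥-elim (asym fp≺fq fp≺fq)
... | tri> _ _ q<p = ⊥-elim (asym fp≺fq (mono q<p))

mono⇒≼ : ∀ {σ π} (f : Fin ∣ σ ∣ → Fin ∣ π ∣) →
  (∀ o {i j} → key o σ i Fin.< key o σ j → key o π (f i) Fin.< key o π (f j)) →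
  σ ≼ π
mono⇒≼ {σ} {π} f mono = record
  { index      = f
  ; increasing = mono position
  ; orderIso   = mk⇔ (mono value)
      (mono⇒reflects (λ p q → π at p Fin.< π at q) Fin.<-asym value σ f (mono value))
  }

module _ (C : Pred Perm ℓ) where

  data Tree : Set ℓ where
    leaf : Tree
    node : (σ : Perm) → C σ → (Fin ∣ σ ∣ → Tree) → Tree

  infixr 5 _▸_
  data Leaf : Tree → Set ℓ where
    root : Leaf leaf
    _▸_  : ∀ {σ c ts} (i : Fin ∣ σ ∣) → Leaf (ts i) → Leaf (node σ c ts)

  infix 4 _<[_]_
  -- Two leaves are compared at the node where their paths part, as entries of the iterated
  -- inflation are.
  data _<[_]_ : ∀ {t} → Leaf t → Key → Leaf t → Set ℓ where
    across : ∀ {o σ c ts i j} {x : Leaf (ts i)} {y : Leaf (ts j)} →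
             key o σ i Fin.< key o σ j →
             _<[_]_ {node σ c ts} (i ▸ x) o (j ▸ y)
    within : ∀ {o σ c ts i} {x y : Leaf (ts i)} →
             x <[ o ] y → _<[_]_ {node σ c ts} (i ▸ x) o (i ▸ y)

  <-asym : ∀ {o t} {x y : Leaf t} → x <[ o ] y → ¬ y <[ o ] x
  <-asym (across i<j) (across j<i) = Fin.<-asym i<j j<i
  <-asym (across i<i) (within _)   = Fin.<-irrefl refl i<i
  <-asym (within _)   (across i<i) = Fin.<-irrefl refl i<i
  <-asym (within x<y) (within y<x) = <-asym x<y y<x

  -- Monotonicity suffices as data: since keys are linear and the leaf order is asymmetric, it
  -- yields both `reflects` and `injective`.
  record Embedding (π : Perm) (t : Tree) : Set ℓ where
    field
      to   : Fin ∣ π ∣ → Leaf t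
      mono : ∀ o {p q} → key o π p Fin.< key o π q → to p <[ o ] to q

    reflects : ∀ o {p q} → to p <[ o ] to q → key o π p Fin.< key o π q
    reflects o = mono⇒reflects _<[ o ]_ <-asym o π to (mono o)

    injective : ∀ {p q} → to p ≡ to q → p ≡ q
    injective {p} {q} eq with Fin.<-cmp p q
    ... | tri≈ _ p≡q _ = p≡q
    ... | tri< p<q _ _ with lt ← mono position p<q rewrite eq = ⊥-elim (<-asym lt lt)
    ... | tri> _ _ q<p with lt ← mono position q<p rewrite eq = ⊥-elim (<-asym lt lt)

  open Embedding

  restrict : ∀ {σ π t} → σ ≼ π → Embedding π t → Embedding σ t
  restrict σ≼π e = record
    { to   = to e ∘ index σ≼π
    ; mono = λ o → mono e o ∘ ≼-mono σ≼π o
    }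

  graft : (t : Tree) → (Leaf t → Tree) → Tree
  graft leaf          s = s root
  graft (node σ c ts) s = node σ c λ i → graft (ts i) (s ∘ (i ▸_))

  graftLeaf : ∀ {t s} (x : Leaf t) → Leaf (s x) → Leaf (graft t s)
  graftLeaf root    y = y
  graftLeaf (i ▸ x) y = i ▸ graftLeaf x y

  graftLeaf-across : ∀ {o t s} {x x′ : Leaf t} {y : Leaf (s x)} {y′ : Leaf (s x′)} →
    x <[ o ] x′ → graftLeaf {s = s} x y <[ o ] graftLeaf x′ y′
  graftLeaf-across (across i<j)  = across i<j
  graftLeaf-across (within x<x′) = within (graftLeaf-across x<x′)

  graftLeaf-within : ∀ {o t s} (x : Leaf t) {y y′ : Leaf (s x)} →
    y <[ o ] y′ → graftLeaf {s = s} x y <[ o ] graftLeaf x y′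
  graftLeaf-within root    y<y′ = y<y′
  graftLeaf-within (i ▸ x) y<y′ = within (graftLeaf-within x y<y′)

  module _ {σ π : Perm} {α : Fin ∣ σ ∣ → Perm} (inflation : IsInflation σ α π) where
    open IsInflation inflation

    copyIndex : ∀ {i} p → block p ≡ i → Fin ∣ α i ∣
    copyIndex {i} p eq = proj₁ (Equivalence.to (copy-block i p) eq)

    copyIndex-mono : ∀ o {i p q} (p∈i : block p ≡ i) (q∈i : block q ≡ i) →
      key o π p Fin.< key o π q →
      key o (α i) (copyIndex p p∈i) Fin.< key o (α i) (copyIndex q q∈i)
    copyIndex-mono o {i} {p} {q} p∈i q∈i p<q =
      mono⇒reflects (λ p q → key o π p Fin.< key o π q) Fin.<-asym o (α i)
        (index (copy i)) (≼-mono (copy i) o)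
        (subst₂ (λ p q → key o π p Fin.< key o π q)
          (sym (proj₂ (Equivalence.to (copy-block i p) p∈i)))
          (sym (proj₂ (Equivalence.to (copy-block i q) q∈i))) p<q)

    block-mono : ∀ o {p q} → ¬ block p ≡ block q →
      key o π p Fin.< key o π q → key o σ (block p) Fin.< key o σ (block q)
    block-mono position p≢q = Equivalence.to (blockPositions p≢q)
    block-mono value    p≢q = Equivalence.to (blockValues p≢q)

    -- The blocks are handed over together with the tree at the leaf of t
    -- representing them, so that no transport along to e i ≡ x is needed.
    inflateEmbedding : ∀ {t} (e : Embedding σ t) (s : Leaf t → Tree) →
      (∀ x i → to e i ≡ x → Embedding (α i) (s x)) → Embedding π (graft t s)
    inflateEmbedding {t} e s es = record { to = place ; mono = place-mono }
      where
      placeIn : ∀ {i} p → block p ≡ i → Leaf (graft t s)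
      placeIn {i} p p∈i = graftLeaf (to e i) (to (es _ i refl) (copyIndex p p∈i))

      place : Fin ∣ π ∣ → Leaf (graft t s)
      place p = placeIn p refl

      place-mono : ∀ o {p q} → key o π p Fin.< key o π q → place p <[ o ] place q
      place-mono o {p} {q} p<q with block p Fin.≟ block q
      ... | no p≢q  = graftLeaf-across (mono e o (block-mono o p≢q p<q))
      ... | yes p≡q = same refl p≡q refl
        where
        -- Both blocks are generalised to variables, so that their equality can be matched with
        -- `refl`.
        same : ∀ {i j} (p∈i : block p ≡ i) → i ≡ j → (q∈j : block q ≡ j) →
          placeIn p p∈i <[ o ] placeIn q q∈j
        same {i} p∈i refl q∈i = graftLeaf-within (to e i)
          (mono (es _ i refl) o (copyIndex-mono o p∈i q∈i p<q))

  module _ (em : ExcludedMiddle ℓ) where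

    ⟨⟩-embeds : ∀ {π} → ⟨ C ⟩ π → ∃ (Embedding π)
    ⟨⟩-embeds (include {σ} c) = node σ c (λ _ → leaf) , record
      { to   = _▸ root
      ; mono = λ _ → across
      }
    ⟨⟩-embeds (down σ≼π x) =
      let t , e = ⟨⟩-embeds x in t , restrict σ≼π e
    ⟨⟩-embeds (inflate {π} (σ , x , α , y , inflation)) =
      _ , inflateEmbedding inflation e (proj₁ ∘ scion) (proj₂ ∘ scion)
      where
      t = proj₁ (⟨⟩-embeds x)
      e = proj₂ (⟨⟩-embeds x)

      blocks : ∀ i → ∃ (Embedding (α i))
      blocks i = ⟨⟩-embeds (proj₂ (y i))

      -- By injectivity a leaf represents at most one entry, which determines the tree to graft
      -- there; a leaf representing none gets the default `leaf`.
      scion : (x : Leaf t) → ∃ λ s → ∀ i → to e i ≡ x → Embedding (α i) s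
      scion x with em {∃ λ i → to e i ≡ x}
      ... | no unused = leaf , λ i eq → ⊥-elim (unused (i , eq))
      ... | yes (i , refl) = proj₁ (blocks i) , λ j eq →
        subst (λ i → Embedding (α j) (proj₁ (blocks i))) (injective e eq)
          (proj₂ (blocks j))

  -- Well-quasi-ordering of leaf-labelled trees

  module _ (K : Preorder ℓ ℓ ℓ) where
    private module K = Preorder K

    LabelledTree : Set ℓ
    LabelledTree = Σ Tree λ t → Leaf t → K.Carrier

    infix 4 _⊑_ _◁_

    -- Trees are compared through the permutations on their leaves, not through their branching.
    record _⊑_ (s t : LabelledTree) : Set ℓ where
      field
        map   : Leaf (proj₁ s) → Leaf (proj₁ t)
        mono  : ∀ o {x y} → x <[ o ] y → map x <[ o ] map y
        label : ∀ x → proj₂ s x K.≲ proj₂ t (map x)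

    open _⊑_ renaming (mono to ⊑-mono)

    ⊑-refl : ∀ {t} → t ⊑ t
    ⊑-refl = record { map = id ; mono = λ _ → id ; label = λ _ → K.refl }

    ⊑-trans : ∀ {s t u} → s ⊑ t → t ⊑ u → s ⊑ u
    ⊑-trans f g = record
      { map   = map g ∘ map f
      ; mono  = λ o → ⊑-mono g o ∘ ⊑-mono f o
      ; label = λ x → K.trans (label f x) (label g (map f x))
      }

    LabelledTrees : Preorder ℓ ℓ ℓ
    LabelledTrees = record
      { Carrier    = LabelledTree
      ; _≈_        = _≡_
      ; _≲_        = _⊑_
      ; isPreorder = record
        { isEquivalence = isEquivalence
        ; reflexive     = λ { refl → ⊑-refl }
        ; trans         = ⊑-trans
        }
      }

    data _◁_ : Rel LabelledTree ℓ where
      child : ∀ {σ c ts k} i → (ts i , k ∘ (i ▸_)) ◁ (node σ c ts , k)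

    ◁-wellFounded : WellFounded _◁_
    ◁-wellFounded (t , k) = accessible t k
      where
      accessible : ∀ t k → Acc _◁_ (t , k)
      accessible leaf          k = acc λ ()
      accessible (node σ c ts) k = acc λ { (child i) → accessible (ts i) _ }

    ◁⇒⊑ : ∀ {s t} → s ◁ t → s ⊑ t
    ◁⇒⊑ (child i) = record
      { map = i ▸_ ; mono = λ _ → within ; label = λ _ → K.refl }

    module _ (em : ExcludedMiddle ℓ) (lwqo : LWQO C) (wqoK : WQO K) where

      Parts : (ℕ → LabelledTree) → Preorder ℓ ℓ ℓ
      Parts = parts em LabelledTrees _◁_

      Decomposition : (ℕ → LabelledTree) → Preorder ℓ ℓ ℓ
      Decomposition y = ⊎-preorder K (C ≀ Parts y)

      -- The tree `t` is kept apart from `y n` so that it can be matched on; the function argument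
      -- turns its children into parts of `y n`.
      decompose : ∀ y n t → (∀ s → s ◁ t → s ◁ y n) →
                  Preorder.Carrier (Decomposition y)
      decompose y n (leaf , k)        _    = inj₁ (k root)
      decompose y n (node σ c ts , k) part = inj₂ record
        { shape = σ ; member = c ; label = λ i → n , _ , part _ (child i) }

      -- For two nodes, `f` places the children and `g i` embeds child `i` into its image: `f`
      -- orders leaves under different children, `g i` those under the same one.
      decompose-reflects : ∀ y {m n} s t
        {f : ∀ r → r ◁ s → r ◁ y m} {g : ∀ r → r ◁ t → r ◁ y n} →
        Preorder._≲_ (Decomposition y) (decompose y m s f) (decompose y n t g) →
        s ⊑ t
      decompose-reflects y (leaf , _) (leaf , _) (inj₁ le) = record
        { map = id ; mono = λ _ → id ; label = λ { root → le } }
      decompose-reflects y (node σ _ _ , _) (node τ _ _ , _) (inj₂ (f , g)) = record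
        { map   = λ { (i ▸ x) → index f i ▸ map (g i) x }
        ; mono  = λ { o (across i<j) → across (≼-mono f o i<j)
                    ; o (within {i = i} x<y) → within (⊑-mono (g i) o x<y) }
        ; label = λ { (i ▸ x) → label (g i) x }
        }

      WQO-LabelledTrees : WQO LabelledTrees
      WQO-LabelledTrees = WQO-fromParts em LabelledTrees _◁_ ◁-wellFounded ◁⇒⊑
        λ y wqoParts →
          let i , j , i<j , le = WQO-⊎ em K (C ≀ Parts y) wqoK
                                   -- The hypothesis on `C` is applied with the immediate subtrees
                                   -- themselves as labels.
                                   (lwqo (Parts y) wqoParts)
                                   (λ n → decompose y n (y n) λ _ → id)
          in  i , j , i<j , decompose-reflects y (y i) (y j) le

-- Encoding labelled permutations as leaf-labelled trees

theorem7p4 : ∀ {ℓ} → ExcludedMiddle ℓ →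
    (C : Pred Perm ℓ) → IsClass C → LWQO C → LWQO ⟨ C ⟩
theorem7p4 {ℓ} em C _ lwqo L wqoL y =
  let i , j , i<j , s⊑t = WQO-LabelledTrees C K em lwqo wqoK (encode ∘ y)
  in  i , j , i<j , decode (y i) (y j) s⊑t
  where
  module L = Preorder L
  open Embedding
  open Labelled

  -- Used and unused leaves are incomparable, so an embedding of trees maps
  -- leaves representing entries to leaves representing entries.
  Unused : Preorder ℓ ℓ ℓ
  Unused = preorder ⊤

  K : Preorder ℓ ℓ ℓ
  K = ⊎-preorder L Unused

  wqoK : WQO K
  wqoK = WQO-⊎ em L Unused wqoL λ _ → 0 , 1 , s≤s z≤n , refl

  module _ (s : Labelled ⟨ C ⟩ L) where

    tree : Tree C
    tree = proj₁ (⟨⟩-embeds C em (member s))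

    embedding : Embedding C (shape s) tree
    embedding = proj₂ (⟨⟩-embeds C em (member s))

    leafLabel : Leaf C tree → L.Carrier ⊎ ⊤
    leafLabel x with em {∃ λ p → to embedding p ≡ x}
    ... | yes (p , _) = inj₁ (label s p)
    ... | no _        = inj₂ tt

    leafLabel-to : ∀ p → leafLabel (to embedding p) ≡ inj₁ (label s p)
    leafLabel-to p with em {∃ λ q → to embedding q ≡ to embedding p}
    ... | yes (q , eq) = cong (inj₁ ∘ label s) (injective embedding eq)
    ... | no unused    = ⊥-elim (unused (p , refl))

    encode : LabelledTree C K
    encode = tree , leafLabel

    -- A left summand is never below a right one, so the leaf `x` must be used.
    preimage : ∀ {l x} → Preorder._≲_ K (inj₁ l) (leafLabel x) →
               ∃ λ p → to embedding p ≡ x × l L.≲ label s p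
    preimage {x = x} le with em {∃ λ p → to embedding p ≡ x}
    preimage (inj₁ le) | yes (p , eq) = p , eq , le

  decode : ∀ s t → _⊑_ C K (encode s) (encode t) → _≼ₗ_ ⟨ C ⟩ L s t
  decode s t s⊑t =
    mono⇒≼ (proj₁ ∘ target)
      -- The order passes from entries of `s` to leaves, across `s⊑t`, and back to entries of `t` by
      -- reflection.
      (λ o i<j → reflects (embedding t) o
        (subst₂ (λ x y → _<[_]_ C x o y)
          (sym (proj₁ (proj₂ (target _)))) (sym (proj₁ (proj₂ (target _))))
          (⊑.mono o (mono (embedding s) o i<j))))
    , λ p → proj₂ (proj₂ (target p))
    where
    module ⊑ = _⊑_ s⊑t

    target : ∀ p → ∃ λ q → to (embedding t) q ≡ ⊑.map (to (embedding s) p) ×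
                           label s p L.≲ label t q
    target p = preimage t
      (subst (λ k → Preorder._≲_ K k (leafLabel t (⊑.map (to (embedding s) p))))
        (leafLabel-to s p) (⊑.label (to (embedding s) p)))
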